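{- Let $k$ be a positive even integer and $a\in\mathbb{Z}/N\mathbb{Z}$. Then in $\mathcal{DZ}(N)_k$ $$\sum_{1\le r<k,\ r\text{ odd}}Z^{a,a}_{r,k-r}=\frac14\Big(2Z^{N,a}_{1,k-1}+2Z^{2a,a}_{1,k-1}-Z^a_{k}+2\delta_{a,\bar0}Z^N_{k}\Big),$$ $$\sum_{1<r<k,\ r\text{ even}}Z^{a,a}_{r,k-r}=\frac14\Big(2Z^{N,a}_{1,k-1}-2Z^{2a,a}_{1,k-1}+Z^a_{k}+2\delta_{a,\bar0}Z^N_{k}\Big).$$
   Context: $N$ is a positive integer. For $k\ge2$, the formal double zeta space $\mathcal{DZ}(N)_k$ at level $N$ is the $\mathbb{Q}$-vector space spanned by formal symbols $Z^{a,b}_{r,s}$ and $Z^a_k$ ($a,b\in\mathbb{Z}/N\mathbb{Z}$, $r,s\ge1$, $r+s=k$) modulo the relations $$Z_{r,s}^{a,b}+Z_{s,r}^{b,a}+\delta_{a,b}Z^a_k=\sum_{\substack{i+j=k\\ i,j\ge1}}\left(\binom{i-1}{r-1}Z^{a+b,b}_{i,j}+\binom{i-1}{s-1}Z^{a+b,a}_{i,j}\right)$$ for all $a,b\in\mathbb{Z}/N\mathbb{Z}$ and $r,s\ge1$ with $r+s=k$. Superscripts are residue classes modulo $N$, so a superscript $N$ denotes the class $\bar0$; $\delta$ is the Kronecker symbol and $\binom00=1$. -}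

module Defs where

open import Algebra.Module.Bundles using (LeftModule)
open import Data.Bool.Base using (if_then_else_)
open import Data.Fin.Base using (Fin; toℕ)
open import Data.Fin.Properties using (_≟_; toℕ<n; toℕ≤n)
open import Data.Integer.Base using (+_)
open import Data.List.Base using (List; []; foldr; tabulate)
open import Data.Nat.Base using (ℕ; zero; suc; _+_; _∸_; _≤_; s≤s; z≤n; NonZero)
open import Data.Nat.Combinatorics using (_C_)
open import Data.Nat.DivMod using (_mod_)
open import Data.Nat.Properties using (+-comm; m+[n∸m]≡n; m<n⇒0<n∸m; ≤-trans; ∸-monoˡ-≤)
open import Data.Product.Base using (_,_)
open import Data.Rational.Base as ℚ using (ℚ; 0ℚ; 1ℚ; _/_)
open import Data.Rational.Properties using (+-*-ring)
open import Level using (0ℓ)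
open import Relation.Binary.PropositionalEquality using (_≡_; refl; trans; cong)
open import Relation.Nullary.Decidable using (does)

-- ℤ/Nℤ is represented by Fin N (N ≥ 1), i.e. by least residues.

0̄ : ∀ {N} .{{_ : NonZero N}} → Fin N
0̄ {N} = 0 mod N

infixl 6 _⊕_
_⊕_ : ∀ {N} .{{_ : NonZero N}} → Fin N → Fin N → Fin N
_⊕_ {N} a b = (toℕ a + toℕ b) mod N

δ : ∀ {N} → Fin N → Fin N → ℚ
δ a b = if does (a ≟ b) then 1ℚ else 0ℚ

ℕ→ℚ : ℕ → ℚ
ℕ→ℚ n = + n / 1

-- The pairs (r , s) with r, s ≥ 1 and r + s = k.  The proofs are irrelevant,
-- so such a pair is determined by r and s.

record Composition (k : ℕ) : Set where
  constructor mkComposition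
  field
    left     : ℕ
    right    : ℕ
    .1≤left  : 1 ≤ left
    .1≤right : 1 ≤ right
    .sum≡    : left + right ≡ k

open Composition public using (left; right)

swap : ∀ {k} → Composition k → Composition k
swap (mkComposition r s 1≤r 1≤s r+s≡k) =
  mkComposition s r 1≤s 1≤r (trans (+-comm s r) r+s≡k)

⟨1,k-1⟩ : ∀ {k} → .(2 ≤ k) → Composition k
⟨1,k-1⟩ {k} 2≤k =
  mkComposition 1 (k ∸ 1) (s≤s z≤n) (∸-monoˡ-≤ 1 2≤k)
    (m+[n∸m]≡n (≤-trans (s≤s z≤n) 2≤k))

-- Each composition (r , k ∸ r), 1 ≤ r < k, exactly once, by increasing r.

compositions : ∀ k → List (Composition k)
compositions zero    = []
compositions (suc n) = tabulate {n = n} λ i →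
  mkComposition (suc (toℕ i)) (n ∸ toℕ i) (s≤s z≤n) (m<n⇒0<n∸m (toℕ<n i))
    (cong suc (m+[n∸m]≡n (toℕ≤n i)))

infixr 8 -ᴹ_
infixr 7 _*ₗ_
infixl 6 _+ᴹ_ _-ᴹ_

-- The formal double zeta space is presented by generators and relations:
-- DZ N k consists of the ℚ-linear expressions in the formal symbols
-- Z a b (r , s) = Z^{a,b}_{r,s} and Zₖ a = Z^a_k, and _≈ᴹ_ below is the least
-- congruence containing the vector space axioms and the double shuffle
-- relations.  The space is the resulting setoid.  Only k ≥ 2 is of interest.

data DZ (N k : ℕ) : Set where
  Z    : Fin N → Fin N → Composition k → DZ N k
  Zₖ   : Fin N → DZ N k
  0ᴹ   : DZ N k
  _+ᴹ_ : DZ N k → DZ N k → DZ N k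
  -ᴹ_  : DZ N k → DZ N k
  _*ₗ_ : ℚ → DZ N k → DZ N k

_-ᴹ_ : ∀ {N k} → DZ N k → DZ N k → DZ N k
x -ᴹ y = x +ᴹ (-ᴹ y)

∑ : ∀ {A : Set} {N k} → List A → (A → DZ N k) → DZ N k
∑ xs f = foldr (λ x y → f x +ᴹ y) 0ᴹ xs

infix 5 ∑
syntax ∑ xs (λ x → e) = ∑[ x ∈ xs ] e

infix 4 _≈ᴹ_

data _≈ᴹ_ {N k} .{{_ : NonZero N}} : DZ N k → DZ N k → Set where
  double-shuffle : ∀ a b (c : Composition k) →
    Z a b c +ᴹ Z b a (swap c) +ᴹ δ a b *ₗ Zₖ a ≈ᴹ
    ∑[ d ∈ compositions k ]
      (ℕ→ℚ ((left d ∸ 1) C (left c ∸ 1))  *ₗ Z (a ⊕ b) b d +ᴹ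
       ℕ→ℚ ((left d ∸ 1) C (right c ∸ 1)) *ₗ Z (a ⊕ b) a d)

  ≈-refl  : ∀ {x} → x ≈ᴹ x
  ≈-sym   : ∀ {x y} → x ≈ᴹ y → y ≈ᴹ x
  ≈-trans : ∀ {x y z} → x ≈ᴹ y → y ≈ᴹ z → x ≈ᴹ z

  +-cong  : ∀ {x x′ y y′} → x ≈ᴹ x′ → y ≈ᴹ y′ → x +ᴹ y ≈ᴹ x′ +ᴹ y′
  neg-cong : ∀ {x x′} → x ≈ᴹ x′ → -ᴹ x ≈ᴹ -ᴹ x′
  *-cong  : ∀ p {x x′} → x ≈ᴹ x′ → p *ₗ x ≈ᴹ p *ₗ x′

  +-assoc     : ∀ x y z → (x +ᴹ y) +ᴹ z ≈ᴹ x +ᴹ (y +ᴹ z)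
  +-commute   : ∀ x y → x +ᴹ y ≈ᴹ y +ᴹ x
  +-identityˡ : ∀ x → 0ᴹ +ᴹ x ≈ᴹ x
  +-inverseˡ  : ∀ x → (-ᴹ x) +ᴹ x ≈ᴹ 0ᴹ

  *-identityˡ : ∀ x → 1ℚ *ₗ x ≈ᴹ x
  *-assoc     : ∀ p q x → (p ℚ.* q) *ₗ x ≈ᴹ p *ₗ (q *ₗ x)
  *-distribˡ  : ∀ p x y → p *ₗ (x +ᴹ y) ≈ᴹ p *ₗ x +ᴹ p *ₗ y
  *-distribʳ  : ∀ x p q → (p ℚ.+ q) *ₗ x ≈ᴹ p *ₗ x +ᴹ q *ₗ x

module _ {N k : ℕ} .{{_ : NonZero N}} where

  private
    V : Set
    V = DZ N k

  +-identityʳ : (x : V) → x +ᴹ 0ᴹ ≈ᴹ x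
  +-identityʳ x = ≈-trans (+-commute x 0ᴹ) (+-identityˡ x)

  +-inverseʳ : (x : V) → x +ᴹ (-ᴹ x) ≈ᴹ 0ᴹ
  +-inverseʳ x = ≈-trans (+-commute x (-ᴹ x)) (+-inverseˡ x)

  idempotent⇒0 : (x : V) → x ≈ᴹ x +ᴹ x → x ≈ᴹ 0ᴹ
  idempotent⇒0 x x≈x+x =
    ≈-trans (≈-sym (+-identityˡ x))
    (≈-trans (+-cong (≈-sym (+-inverseˡ x)) ≈-refl)
    (≈-trans (+-assoc (-ᴹ x) x x)
    (≈-trans (+-cong ≈-refl (≈-sym x≈x+x)) (+-inverseˡ x))))

  *-zeroˡ : (x : V) → 0ℚ *ₗ x ≈ᴹ 0ᴹ
  *-zeroˡ x = idempotent⇒0 (0ℚ *ₗ x) (*-distribʳ x 0ℚ 0ℚ)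

  *-zeroʳ : ∀ p → p *ₗ 0ᴹ {N} {k} ≈ᴹ 0ᴹ
  *-zeroʳ p = idempotent⇒0 (p *ₗ 0ᴹ)
    (≈-trans (*-cong p (≈-sym (+-identityˡ 0ᴹ))) (*-distribˡ p 0ᴹ 0ᴹ))

DZ-leftModule : ∀ N k .{{_ : NonZero N}} → LeftModule +-*-ring 0ℓ 0ℓ
DZ-leftModule N k = record
  { Carrierᴹ = DZ N k
  ; _≈ᴹ_ = _≈ᴹ_
  ; _+ᴹ_ = _+ᴹ_
  ; _*ₗ_ = _*ₗ_
  ; 0ᴹ = 0ᴹ
  ; -ᴹ_ = -ᴹ_
  ; isLeftModule = record
    { isLeftSemimodule = record
      { +ᴹ-isCommutativeMonoid = record
        { isMonoid = record
          { isSemigroup = record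
            { isMagma = record
              { isEquivalence = record
                { refl = ≈-refl ; sym = ≈-sym ; trans = ≈-trans }
              ; ∙-cong = +-cong
              }
            ; assoc = +-assoc
            }
          ; identity = +-identityˡ , +-identityʳ
          }
        ; comm = +-commute
        }
      ; isPreleftSemimodule = record
        { *ₗ-cong = λ { {p} refl → *-cong p }
        ; *ₗ-zeroˡ = *-zeroˡ
        ; *ₗ-distribʳ = *-distribʳ
        ; *ₗ-identityˡ = *-identityˡ
        ; *ₗ-assoc = *-assoc
        ; *ₗ-zeroʳ = *-zeroʳ
        ; *ₗ-distribˡ = *-distribˡ
        }
      }
    ; -ᴹ‿cong = neg-cong
    ; -ᴹ‿inverse = +-inverseˡ , +-inverseʳ
    }
  }

{-# OPTIONS --safe #-}
-- Two combinations of the double shuffle relations suffice.  For superscripts (0̄ , a) and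
-- (r , s) = (1 , k - 1) the symbol Z^{a,0̄}_{k-1,1} cancels, and what is left gives the
-- sum of all Z^{a,a}_{r,s}.  For superscripts (a , a), summing the relations over r with
-- sign (-1)^(r-1) makes every binomial sum vanish except the one in front of
-- Z^{2a,a}_{1,k-1}; as k is even, r and s have the same parity, so swapping r and s does
-- not change the signs, and this gives the difference of the odd and the even sum.

module Submission where

open import Defs
open import Algebra.Bundles using (CommutativeMonoid)
open import Algebra.Module.Bundles using (LeftModule)
import Algebra.Properties.CommutativeMonoid.Sum as CommutativeMonoidSum
import Algebra.Properties.Group as GroupProperties
import Algebra.Solver.CommutativeMonoid as CommutativeMonoidSolver
open import Data.Fin.Base using (Fin; zero; suc; toℕ; fromℕ; opposite)
open import Data.Fin.Permutation using (reverse)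
open import Data.Fin.Properties
  using (_≟_; toℕ<n; toℕ≤n; toℕ-fromℕ; toℕ-fromℕ<; toℕ-injective; opposite-prop; punchInᵢ≢i)
open import Data.Integer.Base as ℤ using (+_)
import Data.Integer.Properties as ℤ
open import Data.List.Base using ([]; _∷_; filter; tabulate)
open import Data.Nat.Base as ℕ using (ℕ; zero; suc; NonZero; _<_; _∸_; s≤s; z≤n; s≤s⁻¹; s<s⁻¹)
open import Data.Nat.Combinatorics using (_C_; nCn≡1; k>n⇒nCk≡0; nCk+nC[k+1]≡[n+1]C[k+1])
open import Data.Nat.DivMod using (m<n⇒m%n≡m)
open import Data.Nat.Divisibility using (_∣_; _∣?_; ∣⇒≤; divides; _∣0; ∣m+n∣m⇒∣n; ∣m∣n⇒∣m+n; ∣-refl; ∣1⇒≡1)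
open import Data.Nat.Properties
  using (+-comm; +-∸-assoc; m∸[m∸n]≡n; m+[n∸m]≡n; m<n⇒m<1+n; m<n⇒0<n∸m; ≤∧≢⇒<)
open import Data.Product.Base using (_×_; _,_)
open import Data.Rational.Base as ℚ using (ℚ; 0ℚ; 1ℚ; _/_; _*_; toℚᵘ)
open import Data.Rational.Properties as ℚ using (toℚᵘ-injective; toℚᵘ-homo-+; toℚᵘ-fromℚᵘ)
open import Data.Rational.Solver using (module +-*-Solver)
open import Data.Rational.Unnormalised.Base as ℚᵘ using (mkℚᵘ; *≡*)
import Data.Rational.Unnormalised.Properties as ℚᵘ
open import Data.Vec.Functional using (removeAt; replicate)
open import Function.Base using (_∘_)
open import Relation.Binary.PropositionalEquality
  using (_≡_; _≢_; refl; sym; trans; cong; cong₂; subst; module ≡-Reasoning)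
import Relation.Binary.Reasoning.Setoid as SetoidReasoning
open import Relation.Nullary.Decidable using (¬?; yes; no; dec-true)
open import Relation.Nullary.Negation using (¬_; contradiction; contradiction-irr)
open import Relation.Unary using (Decidable)

-- Sums with one nonzero term, and naturals as rationals.

sum-single : ∀ {c ℓ} (M : CommutativeMonoid c ℓ) →
             let open CommutativeMonoid M; open CommutativeMonoidSum M using (sum) in
             ∀ {n} (i : Fin n) (t : Fin n → Carrier) →
             (∀ j → j ≢ i → t j ≈ ε) → sum t ≈ t i
sum-single M {suc n} i t vanishes = begin
  sum t                          ≈⟨ sum-remove {i = i} t ⟩
  t i ∙ sum (removeAt t i)       ≈⟨ ∙-congˡ (sum-cong-≋ (λ j → vanishes _ (punchInᵢ≢i i j))) ⟩
  t i ∙ sum (replicate n ε)      ≈⟨ ∙-congˡ (sum-replicate-zero n) ⟩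
  t i ∙ ε                        ≈⟨ identityʳ _ ⟩
  t i                            ∎
  where
  open CommutativeMonoid M
  open CommutativeMonoidSum M
  open SetoidReasoning setoid

-- `ℕ→ℚ` normalises its fraction, which blocks computation on open terms; the unnormalised fractions
-- with denominator 1 add by their numerators.
ℕ→ℚ-homo-+ : ∀ m n → ℕ→ℚ (m ℕ.+ n) ≡ ℕ→ℚ m ℚ.+ ℕ→ℚ n
ℕ→ℚ-homo-+ m n = toℚᵘ-injective (begin
  toℚᵘ (ℕ→ℚ (m ℕ.+ n))                 ≈⟨ toℚᵘ-fromℚᵘ (mkℚᵘ (+ (m ℕ.+ n)) 0) ⟩
  mkℚᵘ (+ (m ℕ.+ n)) 0                 ≈⟨ *≡* (cong (ℤ._* (+ 1)) (sym (cong₂ ℤ._+_ (ℤ.*-identityʳ (+ m)) (ℤ.*-identityʳ (+ n))))) ⟩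
  mkℚᵘ (+ m) 0 ℚᵘ.+ mkℚᵘ (+ n) 0       ≈⟨ ℚᵘ.+-cong (toℚᵘ-fromℚᵘ (mkℚᵘ (+ m) 0)) (toℚᵘ-fromℚᵘ (mkℚᵘ (+ n) 0)) ⟨
  toℚᵘ (ℕ→ℚ m) ℚᵘ.+ toℚᵘ (ℕ→ℚ n)       ≈⟨ toℚᵘ-homo-+ (ℕ→ℚ m) (ℕ→ℚ n) ⟨
  toℚᵘ (ℕ→ℚ m ℚ.+ ℕ→ℚ n)               ∎)
  where open SetoidReasoning ℚᵘ.≃-setoid

-- Alternating signs and parity.

-- ε r = (-1)^(r-1), so that ε 0 = -1.
ε : ℕ → ℚ
ε zero          = ℚ.- 1ℚ
ε (suc zero)    = 1ℚ
ε (suc (suc r)) = ε r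

ε-suc : ∀ r → ε (suc r) ≡ ℚ.- ε r
ε-suc zero          = refl
ε-suc (suc zero)    = refl
ε-suc (suc (suc r)) = ε-suc r

2∣2+n⇒2∣n : ∀ {n} → 2 ∣ suc (suc n) → 2 ∣ n
2∣2+n⇒2∣n 2∣2+n = ∣m+n∣m⇒∣n 2∣2+n ∣-refl

ε-even : ∀ r → 2 ∣ r → ε r ≡ ℚ.- 1ℚ
ε-even zero          _   = refl
ε-even (suc zero)    2∣1 = contradiction (∣1⇒≡1 2∣1) λ ()
ε-even (suc (suc r)) 2∣r = ε-even r (2∣2+n⇒2∣n 2∣r)

ε-odd : ∀ r → ¬ 2 ∣ r → ε r ≡ 1ℚ
ε-odd zero          2∤0 = contradiction (2 ∣0) 2∤0
ε-odd (suc zero)    _   = refl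
ε-odd (suc (suc r)) 2∤r = ε-odd r (2∤r ∘ ∣m∣n⇒∣m+n ∣-refl)

ε-cong-parity : ∀ r s → 2 ∣ r ℕ.+ s → ε r ≡ ε s
ε-cong-parity zero          s 2∣s   = sym (ε-even s 2∣s)
ε-cong-parity (suc zero)    s 2∣1+s = sym (ε-odd s λ 2∣s →
  contradiction (∣1⇒≡1 (∣m+n∣m⇒∣n (subst (2 ∣_) (+-comm 1 s) 2∣1+s) 2∣s)) λ ())
ε-cong-parity (suc (suc r)) s 2∣r+s = ε-cong-parity r s (2∣2+n⇒2∣n 2∣r+s)

-- Alternating sums of binomial coefficients.

open CommutativeMonoidSum ℚ.+-0-commutativeMonoid
  using () renaming (sum to sumℚ; sum-cong-≗ to sumℚ-cong; ∑-distrib-+ to sumℚ-distrib-+)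

-- The expansion of `(1 - 1)^l`, cut off after `n` terms. For `l < n` nothing nonzero is lost, so
-- the value is 1 at `l = 0` and 0 otherwise.
altBinomialSum : ℕ → ℕ → ℚ
altBinomialSum n l = sumℚ {n} λ i → ε (suc (toℕ i)) * ℕ→ℚ (l C toℕ i)

altBinomialSum-pascal : ∀ n l →
  altBinomialSum (suc n) (suc l) ℚ.+ altBinomialSum n l ≡ altBinomialSum (suc n) l
altBinomialSum-pascal n l = begin
  (1ℚ ℚ.+ sumℚ upper) ℚ.+ sumℚ lower          ≡⟨ ℚ.+-assoc 1ℚ (sumℚ upper) (sumℚ lower) ⟩
  1ℚ ℚ.+ (sumℚ upper ℚ.+ sumℚ lower)          ≡⟨ cong (1ℚ ℚ.+_) (sumℚ-distrib-+ upper lower) ⟨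
  1ℚ ℚ.+ sumℚ (λ i → upper i ℚ.+ lower i)     ≡⟨ cong (1ℚ ℚ.+_) (sumℚ-cong {n} (λ i → pascal (toℕ i))) ⟩
  1ℚ ℚ.+ sumℚ target                          ∎
  where
  open ≡-Reasoning

  upper lower target : Fin n → ℚ
  upper  i = ε (2 ℕ.+ toℕ i) * ℕ→ℚ (suc l C suc (toℕ i))
  lower  i = ε (1 ℕ.+ toℕ i) * ℕ→ℚ (l C toℕ i)
  target i = ε (2 ℕ.+ toℕ i) * ℕ→ℚ (l C suc (toℕ i))

  pascal : ∀ i → ε (2 ℕ.+ i) * ℕ→ℚ (suc l C suc i) ℚ.+ ε (1 ℕ.+ i) * ℕ→ℚ (l C i)
               ≡ ε (2 ℕ.+ i) * ℕ→ℚ (l C suc i)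
  pascal i
    rewrite sym (nCk+nC[k+1]≡[n+1]C[k+1] l i)
          | ℕ→ℚ-homo-+ (l C i) (l C suc i)
          | ε-suc i
    -- `ε (2 + i)` computes to `ε i`, so the two neighbouring signs are `e` and `- e`, and the
    -- `l C i` half of Pascal's rule cancels.
    = solve 3 (λ e x y → e :* (x :+ y) :+ (:- e) :* x := e :* y) refl
        (ε i) (ℕ→ℚ (l C i)) (ℕ→ℚ (l C suc i))
    where open +-*-Solver

altBinomialSum-zero : ∀ n → altBinomialSum (suc n) 0 ≡ 1ℚ
altBinomialSum-zero n = sum-single ℚ.+-0-commutativeMonoid zero t vanishes
  where
  t : Fin (suc n) → ℚ
  t i = ε (suc (toℕ i)) * ℕ→ℚ (0 C toℕ i)

  vanishes : ∀ i → i ≢ zero → t i ≡ 0ℚ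
  vanishes zero    0≢0 = contradiction refl 0≢0
  vanishes (suc i) _   = ℚ.*-zeroʳ (ε (2 ℕ.+ toℕ i))

mutual
  -- Mutual induction on `l`. Stability at `l` turns Pascal's rule into `x + y = y`, so `x = 0`;
  -- vanishing at `suc l` for two consecutive cut-offs gives stability at `suc l`.
  altBinomialSum-suc : ∀ n l → suc l < n → altBinomialSum n (suc l) ≡ 0ℚ
  altBinomialSum-suc (suc n) l 1+l<1+n =
    GroupProperties.identityˡ-unique ℚ.+-0-group _ _
      (trans (altBinomialSum-pascal n l) (sym (altBinomialSum-stable n l (s<s⁻¹ 1+l<1+n))))

  altBinomialSum-stable : ∀ n l → l < n → altBinomialSum n l ≡ altBinomialSum (suc n) l
  altBinomialSum-stable (suc n) zero    _     =
    trans (altBinomialSum-zero n) (sym (altBinomialSum-zero (suc n)))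
  altBinomialSum-stable n       (suc l) 1+l<n =
    trans (altBinomialSum-suc n l 1+l<n) (sym (altBinomialSum-suc (suc n) l (m<n⇒m<1+n 1+l<n)))

-- Compositions and their reversal.

Composition-≡ : ∀ {k} {c d : Composition k} → left c ≡ left d → right c ≡ right d → c ≡ d
Composition-≡ refl refl = refl

-- The function tabulated by `compositions (suc n)`, named so that sums over that list become sums
-- over `Fin n`.
compositionAt : ∀ {n} → Fin n → Composition (suc n)
compositionAt {n} i =
  mkComposition (suc (toℕ i)) (n ∸ toℕ i) (s≤s z≤n) (m<n⇒0<n∸m (toℕ<n i))
    (cong suc (m+[n∸m]≡n (toℕ≤n i)))

-- Makes `swap` a permutation of the summation index.
compositionAt-opposite : ∀ {n} (i : Fin n) → compositionAt (opposite i) ≡ swap (compositionAt i)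
compositionAt-opposite {n} i = Composition-≡
  (trans (cong suc (opposite-prop i)) (sym (+-∸-assoc 1 (toℕ<n i))))
  (trans (cong (n ∸_) (opposite-prop i)) (m∸[m∸n]≡n (toℕ<n i)))

-- Kronecker symbol and residue classes.

δ-refl : ∀ {N} (a : Fin N) → δ a a ≡ 1ℚ
δ-refl a rewrite dec-true (a ≟ a) refl = refl

δ-sym : ∀ {N} (a b : Fin N) → δ a b ≡ δ b a
δ-sym a b with a ≟ b | b ≟ a
... | yes _    | yes _   = refl
... | no  _    | no  _   = refl
... | yes a≡b  | no  b≢a = contradiction (sym a≡b) b≢a
... | no  a≢b  | yes b≡a = contradiction (sym b≡a) a≢b

⊕-identityˡ : ∀ {N} .{{_ : NonZero N}} (a : Fin N) → 0̄ ⊕ a ≡ a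
⊕-identityˡ {N} a = toℕ-injective (begin
  toℕ (0̄ ⊕ a)                     ≡⟨ toℕ-fromℕ< _ ⟩
  (toℕ (0̄ {N}) ℕ.+ toℕ a) ℕ.% N   ≡⟨ cong (λ z → (z ℕ.+ toℕ a) ℕ.% N) (trans (toℕ-fromℕ< _) (m<n⇒m%n≡m (ℕ.>-nonZero⁻¹ N))) ⟩
  toℕ a ℕ.% N                     ≡⟨ m<n⇒m%n≡m (toℕ<n a) ⟩
  toℕ a                           ∎)
  where open ≡-Reasoning

-- Linear algebra and finite sums in the double zeta space.

module _ {N k : ℕ} .{{_ : NonZero N}} where

  open LeftModule (DZ-leftModule N k) using (≈ᴹ-setoid; +ᴹ-group; +ᴹ-commutativeMonoid)
  open CommutativeMonoidSum +ᴹ-commutativeMonoid using (sum)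
  open CommutativeMonoidSolver +ᴹ-commutativeMonoid using (solve; _⊜_) renaming (_⊕_ to _⊞_)
  open SetoidReasoning ≈ᴹ-setoid

  private
    V : Set
    V = DZ N k

  ≡⇒≈ᴹ : {x y : V} → x ≡ y → x ≈ᴹ y
  ≡⇒≈ᴹ refl = ≈-refl

  *ₗ-congʳ : ∀ {p q} (x : V) → p ≡ q → p *ₗ x ≈ᴹ q *ₗ x
  *ₗ-congʳ x refl = ≈-refl

  2*ₗx≈x+x : (x : V) → ℕ→ℚ 2 *ₗ x ≈ᴹ x +ᴹ x
  2*ₗx≈x+x x = ≈-trans (*-distribʳ x 1ℚ 1ℚ) (+-cong (*-identityˡ x) (*-identityˡ x))

  -1*ₗx+x≈0 : (x : V) → (ℚ.- 1ℚ) *ₗ x +ᴹ x ≈ᴹ 0ᴹ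
  -1*ₗx+x≈0 x = begin
    (ℚ.- 1ℚ) *ₗ x +ᴹ x           ≈⟨ +-cong ≈-refl (*-identityˡ x) ⟨
    (ℚ.- 1ℚ) *ₗ x +ᴹ 1ℚ *ₗ x     ≈⟨ *-distribʳ x (ℚ.- 1ℚ) 1ℚ ⟨
    0ℚ *ₗ x                      ≈⟨ *-zeroˡ x ⟩
    0ᴹ                           ∎

  4x+y≈z⇒x≈¼[z-y] : (x y z : V) → (x +ᴹ x) +ᴹ (x +ᴹ x) +ᴹ y ≈ᴹ z → x ≈ᴹ (+ 1 / 4) *ₗ (z -ᴹ y)
  4x+y≈z⇒x≈¼[z-y] x y z 4x+y≈z = begin
    x                                            ≈⟨ *-identityˡ x ⟨
    -- Closed rationals compute: `1ℚ` is `(+ 1 / 4) * ℕ→ℚ 4`, and `ℕ→ℚ 4` is `ℕ→ℚ 2 ℚ.+ ℕ→ℚ 2`.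
    1ℚ *ₗ x                                      ≈⟨ *-assoc (+ 1 / 4) (ℕ→ℚ 4) x ⟩
    (+ 1 / 4) *ₗ ((ℕ→ℚ 2 ℚ.+ ℕ→ℚ 2) *ₗ x)        ≈⟨ *-cong _ (*-distribʳ x (ℕ→ℚ 2) (ℕ→ℚ 2)) ⟩
    (+ 1 / 4) *ₗ (ℕ→ℚ 2 *ₗ x +ᴹ ℕ→ℚ 2 *ₗ x)      ≈⟨ *-cong _ (+-cong (2*ₗx≈x+x x) (2*ₗx≈x+x x)) ⟩
    (+ 1 / 4) *ₗ ((x +ᴹ x) +ᴹ (x +ᴹ x))          ≈⟨ *-cong _ (GroupProperties.x≈z//y +ᴹ-group _ _ _ 4x+y≈z) ⟩
    (+ 1 / 4) *ₗ (z -ᴹ y)                        ∎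

  ∑-tabulate : ∀ {A : Set} {n} (t : Fin n → A) (f : A → V) → ∑ (tabulate t) f ≡ sum (f ∘ t)
  ∑-tabulate {n = zero}  t f = refl
  ∑-tabulate {n = suc n} t f = cong (f (t zero) +ᴹ_) (∑-tabulate (t ∘ suc) f)

  *ₗ-sum : ∀ {n} p (t : Fin n → V) → p *ₗ sum t ≈ᴹ sum (λ i → p *ₗ t i)
  *ₗ-sum {zero}  p t = *-zeroʳ p
  *ₗ-sum {suc n} p t = ≈-trans (*-distribˡ p _ _) (+-cong ≈-refl (*ₗ-sum p (t ∘ suc)))

  sum-*ₗ : ∀ {n} (p : Fin n → ℚ) (x : V) → sumℚ p *ₗ x ≈ᴹ sum (λ i → p i *ₗ x)
  sum-*ₗ {zero}  p x = *-zeroˡ x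
  sum-*ₗ {suc n} p x = ≈-trans (*-distribʳ x _ _) (+-cong ≈-refl (sum-*ₗ (p ∘ suc) x))

  module _ {A : Set} {P : A → Set} (P? : Decidable P) (f : A → V) where

    ∑-partition : ∀ xs → ∑ (filter (¬? ∘ P?) xs) f +ᴹ ∑ (filter P? xs) f ≈ᴹ ∑ xs f
    ∑-partition []       = +-identityˡ 0ᴹ
    ∑-partition (x ∷ xs) with P? x
    ... | yes _ = begin
      _ +ᴹ (f x +ᴹ _)     ≈⟨ solve 3 (λ o y e → o ⊞ (y ⊞ e) ⊜ y ⊞ (o ⊞ e)) ≈-refl _ _ _ ⟩
      f x +ᴹ (_ +ᴹ _)     ≈⟨ +-cong ≈-refl (∑-partition xs) ⟩
      f x +ᴹ ∑ xs f       ∎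
    ... | no  _ = ≈-trans (+-assoc _ _ _) (+-cong ≈-refl (∑-partition xs))

    module _ (s : A → ℚ) (s-yes : ∀ x → P x → s x ≡ ℚ.- 1ℚ) (s-no : ∀ x → ¬ P x → s x ≡ 1ℚ) where

      -- The signed sum is the sum outside `P` minus the sum over `P`; moving the latter across
      -- leaves an identity without subtraction, suited to the monoid solver.
      ∑-signed : ∀ xs → ∑ (filter (¬? ∘ P?) xs) f ≈ᴹ ∑ (filter P? xs) f +ᴹ ∑ xs (λ x → s x *ₗ f x)
      ∑-signed []       = ≈-sym (+-identityˡ 0ᴹ)
      ∑-signed (x ∷ xs) with P? x
      ... | yes px = begin
        _                                          ≈⟨ ∑-signed xs ⟩
        _ +ᴹ _                                     ≈⟨ +-identityˡ _ ⟨
        -- Zero is split as `- f x + f x`: one half heads the signed sum, the other the sum over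
        -- `P`.
        0ᴹ +ᴹ (_ +ᴹ _)                             ≈⟨ +-cong (-1*ₗx+x≈0 (f x)) ≈-refl ⟨
        ((ℚ.- 1ℚ) *ₗ f x +ᴹ f x) +ᴹ (_ +ᴹ _)       ≈⟨ +-cong (+-cong (*ₗ-congʳ (f x) (s-yes x px)) ≈-refl) ≈-refl ⟨
        (s x *ₗ f x +ᴹ f x) +ᴹ (_ +ᴹ _)            ≈⟨ solve 4 (λ y z e d → (y ⊞ z) ⊞ (e ⊞ d) ⊜ (z ⊞ e) ⊞ (y ⊞ d)) ≈-refl _ _ _ _ ⟩
        (f x +ᴹ _) +ᴹ (s x *ₗ f x +ᴹ _)            ∎
      ... | no ¬px = begin
        f x +ᴹ _                                   ≈⟨ +-cong (*-identityˡ (f x)) (≈-sym (∑-signed xs)) ⟨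
        1ℚ *ₗ f x +ᴹ (_ +ᴹ _)                      ≈⟨ +-cong (*ₗ-congʳ (f x) (s-no x ¬px)) ≈-refl ⟨
        s x *ₗ f x +ᴹ (_ +ᴹ _)                     ≈⟨ solve 3 (λ y e d → y ⊞ (e ⊞ d) ⊜ e ⊞ (y ⊞ d)) ≈-refl _ _ _ ⟩
        _ +ᴹ (s x *ₗ f x +ᴹ _)                     ∎

  -- The number of terms is odd. As `ε` has period two by definition, dropping two terms leaves the
  -- same sum for a smaller `m`.
  sum-ε-const : ∀ m (x : V) → sum {suc (m ℕ.* 2)} (λ i → ε (suc (toℕ i)) *ₗ x) ≈ᴹ x
  sum-ε-const zero    x = ≈-trans (+-identityʳ _) (*-identityˡ x)
  sum-ε-const (suc m) x = begin
    1ℚ *ₗ x +ᴹ ((ℚ.- 1ℚ) *ₗ x +ᴹ _)   ≈⟨ +-cong (*-identityˡ x) (+-cong ≈-refl (sum-ε-const m x)) ⟩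
    x +ᴹ ((ℚ.- 1ℚ) *ₗ x +ᴹ x)         ≈⟨ +-cong ≈-refl (-1*ₗx+x≈0 x) ⟩
    x +ᴹ 0ᴹ                           ≈⟨ +-identityʳ x ⟩
    x                                 ∎

-- Alternating sums over the compositions of an even weight.

module _ {N : ℕ} .{{_ : NonZero N}} (m : ℕ) where

  private
    n k : ℕ
    -- There are `n = k - 1` compositions, an odd number, and `suc m ℕ.* 2` computes to `k`.
    n = suc (m ℕ.* 2)
    k = suc n

    V : Set
    V = DZ N k

  open LeftModule (DZ-leftModule N k) using (≈ᴹ-setoid; +ᴹ-group; +ᴹ-commutativeMonoid)
  open CommutativeMonoidSum +ᴹ-commutativeMonoid
  open CommutativeMonoidSolver +ᴹ-commutativeMonoid using (solve; _⊜_) renaming (_⊕_ to _⊞_)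
  open SetoidReasoning ≈ᴹ-setoid

  alternating : (Composition k → V) → V
  alternating f = sum {n} λ i → ε (suc (toℕ i)) *ₗ f (compositionAt i)

  alternating-cong : ∀ {f g} → (∀ c → f c ≈ᴹ g c) → alternating f ≈ᴹ alternating g
  alternating-cong f≈g = sum-cong-≋ {n} λ i → *-cong (ε (suc (toℕ i))) (f≈g (compositionAt i))

  alternating-+ : ∀ f g → alternating (λ c → f c +ᴹ g c) ≈ᴹ alternating f +ᴹ alternating g
  alternating-+ f g = ≈-trans
    (sum-cong-≋ {n} λ i → *-distribˡ (ε (suc (toℕ i))) (f (compositionAt i)) (g (compositionAt i)))
    (∑-distrib-+ {n} (λ i → ε (suc (toℕ i)) *ₗ f (compositionAt i)) (λ i → ε (suc (toℕ i)) *ₗ g (compositionAt i)))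

  -- k is even, so left c and right c have the same parity.
  alternating-swap : ∀ f → alternating (f ∘ swap) ≈ᴹ alternating f
  alternating-swap f = begin
    sum (λ i → ε (suc (toℕ i)) *ₗ f (swap (compositionAt i)))
      ≡⟨ sum-cong-≗ (λ i → cong₂ (λ e c → e *ₗ f c) (ε-opposite i) (sym (compositionAt-opposite i))) ⟩
    sum (λ i → ε (suc (toℕ (opposite i))) *ₗ f (compositionAt (opposite i)))
      ≈⟨ sum-permute (λ i → ε (suc (toℕ i)) *ₗ f (compositionAt i)) reverse ⟨
    alternating f ∎
    where
    ε-opposite : ∀ (i : Fin n) → ε (suc (toℕ i)) ≡ ε (suc (toℕ (opposite i)))
    ε-opposite i = trans
      (ε-cong-parity (suc (toℕ i)) (n ∸ toℕ i)
        (divides (suc m) (cong suc (m+[n∸m]≡n (toℕ≤n i)))))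
      (cong ε (sym (cong left (compositionAt-opposite i))))

  -- `toℕ j` is `left d ∸ 1` for `d = compositionAt j`, so this is a summand of the double shuffle
  -- relation by computation.
  binomialTerm : (Composition k → V) → Composition k → Fin n → V
  binomialTerm f c j = ℕ→ℚ (toℕ j C (left c ∸ 1)) *ₗ f (compositionAt j)

  binomialSum : (Composition k → V) → Composition k → V
  binomialSum f c = sum (binomialTerm f c)

  -- After exchanging the sums, the coefficient of `f (compositionAt j)` is
  -- `altBinomialSum n (toℕ j)`. Since `toℕ j < n`, it vanishes except at `j = 0`, where it is 1.
  alternating-binomialSum : ∀ f → alternating (binomialSum f) ≈ᴹ f (compositionAt zero)
  alternating-binomialSum f = begin
    sum (λ i → e i *ₗ sum (λ j → b i j *ₗ F j))     ≈⟨ sum-cong-≋ (λ i → *ₗ-sum (e i) (λ j → b i j *ₗ F j)) ⟩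
    sum (λ i → sum (λ j → e i *ₗ (b i j *ₗ F j)))   ≈⟨ ∑-comm (λ i j → e i *ₗ (b i j *ₗ F j)) ⟩
    sum (λ j → sum (λ i → e i *ₗ (b i j *ₗ F j)))   ≈⟨ sum-cong-≋ (λ j → sum-cong-≋ (λ i → ≈-sym (*-assoc (e i) (b i j) (F j)))) ⟩
    sum (λ j → sum (λ i → (e i * b i j) *ₗ F j))    ≈⟨ sum-cong-≋ (λ j → ≈-sym (sum-*ₗ (λ i → e i * b i j) (F j))) ⟩
    sum (λ j → altBinomialSum n (toℕ j) *ₗ F j)     ≈⟨ sum-single +ᴹ-commutativeMonoid zero _ vanishes ⟩
    altBinomialSum n 0 *ₗ F zero                    ≈⟨ *ₗ-congʳ (F zero) (altBinomialSum-zero (m ℕ.* 2)) ⟩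
    1ℚ *ₗ F zero                                    ≈⟨ *-identityˡ (F zero) ⟩
    F zero                                          ∎
    where
    e : Fin n → ℚ
    e i = ε (suc (toℕ i))

    b : Fin n → Fin n → ℚ
    b i j = ℕ→ℚ (toℕ j C toℕ i)

    F : Fin n → V
    F = f ∘ compositionAt

    vanishes : ∀ j → j ≢ zero → altBinomialSum n (toℕ j) *ₗ F j ≈ᴹ 0ᴹ
    vanishes zero    0≢0 = contradiction refl 0≢0
    vanishes (suc j) _   =
      ≈-trans (*ₗ-congʳ (F (suc j)) (altBinomialSum-suc n (toℕ j) (toℕ<n (suc j)))) (*-zeroˡ _)

  ∑-compositions : ∀ f → ∑ (compositions k) f ≈ᴹ sum (f ∘ compositionAt)
  ∑-compositions f = ≡⇒≈ᴹ (∑-tabulate compositionAt f)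

  -- The two combinations of relations and their solution.

  module _ (a : Fin N) where

    private
      -- These are `(1 , k - 1)` and `(k - 1 , 1)`. The index `opposite zero` lets
      -- `compositionAt-opposite` identify `final` with `swap first`.
      first final : Composition k
      first = compositionAt zero
      final = compositionAt (opposite {n} zero)

    -- In the relation for `0̄`, `a` and `first`, the binomials `(i - 1) C 0` are all 1, while
    -- `(i - 1) C (k - 2)` is nonzero only at `i = k - 1`. The surviving `Z a 0̄ final` also stands
    -- on the left and cancels.
    sum-all : ∑ (compositions k) (Z a a) ≈ᴹ Z 0̄ a first +ᴹ δ a 0̄ *ₗ Zₖ 0̄
    sum-all = GroupProperties.∙-cancelʳ +ᴹ-group (Z a 0̄ final) _ _ (begin
      ∑ (compositions k) (Z a a) +ᴹ Z a 0̄ final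
        ≈⟨ +-cong (∑-compositions (Z a a)) (≈-sym top) ⟩
      sum (λ j → Z a a (compositionAt j)) +ᴹ sum (λ j → b j *ₗ Z a 0̄ (compositionAt j))
        ≈⟨ ∑-distrib-+ (λ j → Z a a (compositionAt j)) (λ j → b j *ₗ Z a 0̄ (compositionAt j)) ⟨
      sum (λ j → Z a a (compositionAt j) +ᴹ b j *ₗ Z a 0̄ (compositionAt j))
        -- The scalar `1ℚ` is what `toℕ j C 0` computes to in the relation.
        ≈⟨ sum-cong-≋ {n} (λ j → +-cong (≈-sym (*-identityˡ (Z a a (compositionAt j)))) (≈-refl {x = b j *ₗ Z a 0̄ (compositionAt j)})) ⟩
      sum (λ j → 1ℚ *ₗ Z a a (compositionAt j) +ᴹ b j *ₗ Z a 0̄ (compositionAt j))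
        ≡⟨ cong (λ x → sum {n} (λ j → 1ℚ *ₗ Z x a (compositionAt j) +ᴹ b j *ₗ Z x 0̄ (compositionAt j))) (⊕-identityˡ a) ⟨
      sum (λ j → 1ℚ *ₗ Z (0̄ ⊕ a) a (compositionAt j) +ᴹ b j *ₗ Z (0̄ ⊕ a) 0̄ (compositionAt j))
        ≈⟨ ∑-compositions _ ⟨
      _
        ≈⟨ double-shuffle 0̄ a first ⟨
      Z 0̄ a first +ᴹ Z a 0̄ (swap first) +ᴹ δ 0̄ a *ₗ Zₖ 0̄
        ≈⟨ +-cong (+-cong ≈-refl (≡⇒≈ᴹ (cong (Z a 0̄) (sym (compositionAt-opposite {n} zero))))) (*ₗ-congʳ (Zₖ 0̄) (δ-sym 0̄ a)) ⟩
      Z 0̄ a first +ᴹ Z a 0̄ final +ᴹ δ a 0̄ *ₗ Zₖ 0̄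
        ≈⟨ solve 3 (λ x y z → (x ⊞ y) ⊞ z ⊜ (x ⊞ z) ⊞ y) ≈-refl _ _ _ ⟩
      Z 0̄ a first +ᴹ δ a 0̄ *ₗ Zₖ 0̄ +ᴹ Z a 0̄ final
        ∎)
      where
      b : Fin n → ℚ
      b j = ℕ→ℚ (toℕ j C (m ℕ.* 2))

      top : sum (λ j → b j *ₗ Z a 0̄ (compositionAt j)) ≈ᴹ Z a 0̄ final
      top = begin
        sum (λ j → b j *ₗ Z a 0̄ (compositionAt j))
          ≈⟨ sum-single +ᴹ-commutativeMonoid (fromℕ (m ℕ.* 2)) _ vanishes ⟩
        b (fromℕ (m ℕ.* 2)) *ₗ Z a 0̄ final
          ≈⟨ *ₗ-congʳ _ (cong ℕ→ℚ (trans (cong (_C (m ℕ.* 2)) (toℕ-fromℕ (m ℕ.* 2))) (nCn≡1 (m ℕ.* 2)))) ⟩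
        1ℚ *ₗ Z a 0̄ final
          ≈⟨ *-identityˡ _ ⟩
        Z a 0̄ final ∎
        where
        vanishes : ∀ j → j ≢ fromℕ (m ℕ.* 2) → b j *ₗ Z a 0̄ (compositionAt j) ≈ᴹ 0ᴹ
        vanishes j j≢last = ≈-trans
          (*ₗ-congʳ _ (cong ℕ→ℚ (k>n⇒nCk≡0 (≤∧≢⇒< (s≤s⁻¹ (toℕ<n j))
            λ j≡last → j≢last (toℕ-injective (trans j≡last (sym (toℕ-fromℕ (m ℕ.* 2)))))))))
          (*-zeroˡ _)

    -- The second `D` arises from `swap`, and `Zₖ a` occurs once because the number of relations is
    -- odd. With equal superscripts the two binomial sums are `B c` and `B (swap c)`, so both
    -- contribute the same symbol.
    alternating-relation : let D = alternating (Z a a) in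
      D +ᴹ D +ᴹ Zₖ a ≈ᴹ Z (a ⊕ a) a first +ᴹ Z (a ⊕ a) a first
    alternating-relation = begin
      D +ᴹ D +ᴹ Zₖ a
        ≈⟨ +-cong (+-cong ≈-refl (≈-sym (alternating-swap (Z a a)))) (≈-sym (sum-ε-const m (Zₖ a))) ⟩
      D +ᴹ alternating (Z a a ∘ swap) +ᴹ alternating (λ _ → Zₖ a)
        ≈⟨ +-cong (alternating-+ (Z a a) (Z a a ∘ swap)) ≈-refl ⟨
      alternating (λ c → Z a a c +ᴹ Z a a (swap c)) +ᴹ alternating (λ _ → Zₖ a)
        ≈⟨ alternating-+ (λ c → Z a a c +ᴹ Z a a (swap c)) (λ _ → Zₖ a) ⟨
      alternating (λ c → Z a a c +ᴹ Z a a (swap c) +ᴹ Zₖ a)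
        ≈⟨ alternating-cong relation ⟩
      alternating (λ c → B c +ᴹ B (swap c))
        ≈⟨ alternating-+ B (B ∘ swap) ⟩
      alternating B +ᴹ alternating (B ∘ swap)
        ≈⟨ +-cong ≈-refl (alternating-swap B) ⟩
      alternating B +ᴹ alternating B
        ≈⟨ +-cong (alternating-binomialSum W) (alternating-binomialSum W) ⟩
      W first +ᴹ W first ∎
      where
      D : V
      D = alternating (Z a a)

      W B : Composition k → V
      W = Z (a ⊕ a) a
      B = binomialSum W

      relation : ∀ c → Z a a c +ᴹ Z a a (swap c) +ᴹ Zₖ a ≈ᴹ B c +ᴹ B (swap c)
      relation c = begin
        Z a a c +ᴹ Z a a (swap c) +ᴹ Zₖ a
          ≈⟨ +-cong ≈-refl (≈-trans (*ₗ-congʳ (Zₖ a) (δ-refl a)) (*-identityˡ (Zₖ a))) ⟨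
        Z a a c +ᴹ Z a a (swap c) +ᴹ δ a a *ₗ Zₖ a
          ≈⟨ double-shuffle a a c ⟩
        _
          ≈⟨ ∑-compositions _ ⟩
        _
          ≈⟨ ∑-distrib-+ {n} (binomialTerm W c) (binomialTerm W (swap c)) ⟩
        B c +ᴹ B (swap c) ∎

    private
      O E X Y K G : V
      O = ∑ (filter (λ c → ¬? (2 ∣? left c)) (compositions k)) (Z a a)
      E = ∑ (filter (λ c → 2 ∣? left c) (compositions k)) (Z a a)
      X = Z 0̄ a first
      Y = δ a 0̄ *ₗ Zₖ 0̄
      K = Zₖ a
      G = Z (a ⊕ a) a first

    O+E≈X+Y : O +ᴹ E ≈ᴹ X +ᴹ Y
    O+E≈X+Y = ≈-trans (∑-partition (λ c → 2 ∣? left c) (Z a a) (compositions k)) sum-all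

    O≈E+D : O ≈ᴹ E +ᴹ alternating (Z a a)
    O≈E+D = ≈-trans
      (∑-signed (λ c → 2 ∣? left c) (Z a a) (ε ∘ left) (ε-even ∘ left) (ε-odd ∘ left) (compositions k))
      (+-cong ≈-refl (∑-compositions _))

    2Y≈ : (ℕ→ℚ 2 * δ a 0̄) *ₗ Zₖ 0̄ ≈ᴹ Y +ᴹ Y
    2Y≈ = ≈-trans (*-assoc _ _ _) (2*ₗx≈x+x Y)

    -- Rests on `4O = 2(O + E) + 2(O - E)`, where `O + E = X + Y`, `O - E = D` and `2D + K = 2G`.
    odd-sum : O ≈ᴹ (+ 1 / 4) *ₗ
      (ℕ→ℚ 2 *ₗ X +ᴹ ℕ→ℚ 2 *ₗ G -ᴹ K +ᴹ (ℕ→ℚ 2 * δ a 0̄) *ₗ Zₖ 0̄)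
    odd-sum = begin
      O
        ≈⟨ 4x+y≈z⇒x≈¼[z-y] O K _ 4O+K ⟩
      (+ 1 / 4) *ₗ ((X +ᴹ Y) +ᴹ (X +ᴹ Y) +ᴹ (G +ᴹ G) -ᴹ K)
        -- The monoid solver knows no negation, so `-ᴹ K` enters as an atom.
        ≈⟨ *-cong _ (solve 4 (λ x y g k → (((x ⊞ y) ⊞ (x ⊞ y)) ⊞ (g ⊞ g)) ⊞ k ⊜ (((x ⊞ x) ⊞ (g ⊞ g)) ⊞ k) ⊞ (y ⊞ y)) ≈-refl X Y G (-ᴹ K)) ⟩
      (+ 1 / 4) *ₗ ((X +ᴹ X) +ᴹ (G +ᴹ G) -ᴹ K +ᴹ (Y +ᴹ Y))
        ≈⟨ *-cong _ (+-cong (+-cong (+-cong (2*ₗx≈x+x X) (2*ₗx≈x+x G)) ≈-refl) 2Y≈) ⟨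
      _ ∎
      where
      D = alternating (Z a a)

      4O+K : (O +ᴹ O) +ᴹ (O +ᴹ O) +ᴹ K ≈ᴹ (X +ᴹ Y) +ᴹ (X +ᴹ Y) +ᴹ (G +ᴹ G)
      4O+K = begin
        (O +ᴹ O) +ᴹ (O +ᴹ O) +ᴹ K
          -- Only two of the four copies of `O` are replaced: the other two pair with the new `E`s.
          ≈⟨ +-cong (+-cong ≈-refl (+-cong O≈E+D O≈E+D)) ≈-refl ⟩
        (O +ᴹ O) +ᴹ ((E +ᴹ D) +ᴹ (E +ᴹ D)) +ᴹ K
          ≈⟨ solve 4 (λ o e d k → ((o ⊞ o) ⊞ ((e ⊞ d) ⊞ (e ⊞ d))) ⊞ k ⊜ ((o ⊞ e) ⊞ (o ⊞ e)) ⊞ ((d ⊞ d) ⊞ k)) ≈-refl O E D K ⟩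
        (O +ᴹ E) +ᴹ (O +ᴹ E) +ᴹ (D +ᴹ D +ᴹ K)
          ≈⟨ +-cong (+-cong O+E≈X+Y O+E≈X+Y) alternating-relation ⟩
        (X +ᴹ Y) +ᴹ (X +ᴹ Y) +ᴹ (G +ᴹ G) ∎

    -- Here `4E + 2D = 2(O + E)`; adding `K` to both sides turns `2D + K` into `2G`.
    even-sum : E ≈ᴹ (+ 1 / 4) *ₗ
      (ℕ→ℚ 2 *ₗ X -ᴹ ℕ→ℚ 2 *ₗ G +ᴹ K +ᴹ (ℕ→ℚ 2 * δ a 0̄) *ₗ Zₖ 0̄)
    even-sum = begin
      E
        ≈⟨ 4x+y≈z⇒x≈¼[z-y] E (G +ᴹ G) _ 4E+2G ⟩
      (+ 1 / 4) *ₗ ((X +ᴹ Y) +ᴹ (X +ᴹ Y) +ᴹ K -ᴹ (G +ᴹ G))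
        ≈⟨ *-cong _ (solve 4 (λ x y g k → (((x ⊞ y) ⊞ (x ⊞ y)) ⊞ k) ⊞ g ⊜ (((x ⊞ x) ⊞ g) ⊞ k) ⊞ (y ⊞ y)) ≈-refl X Y (-ᴹ (G +ᴹ G)) K) ⟩
      (+ 1 / 4) *ₗ ((X +ᴹ X) -ᴹ (G +ᴹ G) +ᴹ K +ᴹ (Y +ᴹ Y))
        ≈⟨ *-cong _ (+-cong (+-cong (+-cong (2*ₗx≈x+x X) (neg-cong (2*ₗx≈x+x G))) ≈-refl) 2Y≈) ⟨
      _ ∎
      where
      D = alternating (Z a a)

      4E+2G : (E +ᴹ E) +ᴹ (E +ᴹ E) +ᴹ (G +ᴹ G) ≈ᴹ (X +ᴹ Y) +ᴹ (X +ᴹ Y) +ᴹ K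
      4E+2G = begin
        (E +ᴹ E) +ᴹ (E +ᴹ E) +ᴹ (G +ᴹ G)
          ≈⟨ +-cong ≈-refl alternating-relation ⟨
        (E +ᴹ E) +ᴹ (E +ᴹ E) +ᴹ (D +ᴹ D +ᴹ K)
          ≈⟨ solve 3 (λ e d k → ((e ⊞ e) ⊞ (e ⊞ e)) ⊞ ((d ⊞ d) ⊞ k) ⊜ (((e ⊞ d) ⊞ e) ⊞ ((e ⊞ d) ⊞ e)) ⊞ k) ≈-refl E D K ⟩
        ((E +ᴹ D) +ᴹ E) +ᴹ ((E +ᴹ D) +ᴹ E) +ᴹ K
          ≈⟨ +-cong (+-cong (+-cong O≈E+D ≈-refl) (+-cong O≈E+D ≈-refl)) ≈-refl ⟨
        (O +ᴹ E) +ᴹ (O +ᴹ E) +ᴹ K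
          ≈⟨ +-cong (+-cong O+E≈X+Y O+E≈X+Y) ≈-refl ⟩
        (X +ᴹ Y) +ᴹ (X +ᴹ Y) +ᴹ K ∎

theorem3p3 : (N : ℕ) .{{_ : NonZero N}} (k : ℕ) .{{_ : NonZero k}} (2∣k : 2 ∣ k) (a : Fin N) →
  ((∑[ c ∈ filter (λ c → ¬? (2 ∣? left c)) (compositions k) ] Z a a c)
    ≈ᴹ (+ 1 / 4) *ₗ
        (ℕ→ℚ 2 *ₗ Z 0̄ a (⟨1,k-1⟩ (∣⇒≤ 2∣k)) +ᴹ ℕ→ℚ 2 *ₗ Z (a ⊕ a) a (⟨1,k-1⟩ (∣⇒≤ 2∣k))
          -ᴹ Zₖ a +ᴹ (ℕ→ℚ 2 * δ a 0̄) *ₗ Zₖ 0̄))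
  ×
  ((∑[ c ∈ filter (λ c → 2 ∣? left c) (compositions k) ] Z a a c)
    ≈ᴹ (+ 1 / 4) *ₗ
        (ℕ→ℚ 2 *ₗ Z 0̄ a (⟨1,k-1⟩ (∣⇒≤ 2∣k)) -ᴹ ℕ→ℚ 2 *ₗ Z (a ⊕ a) a (⟨1,k-1⟩ (∣⇒≤ 2∣k))
          +ᴹ Zₖ a +ᴹ (ℕ→ℚ 2 * δ a 0̄) *ₗ Zₖ 0̄))
-- Here `k` is 0. The instance `NonZero k` is irrelevant, hence the irrelevant form of
-- contradiction.
theorem3p3 N k (divides zero    refl) a = contradiction-irr refl (ℕ.≢-nonZero⁻¹ 0)
-- `⟨1,k-1⟩` and `compositionAt zero` agree by computation, their proof fields being irrelevant.
theorem3p3 N k (divides (suc m) refl) a = odd-sum m a , even-sum m a
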